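{- Let $\approx$ be the congruence on the set $\mathcal{T}$ of types generated by a family of recursive equations $X_i \approx F_i$ ($i\in I$), where $F_i \in \mathcal{T}$, and assume that $\approx$ is good. Then every $\lambda$-term that is typable in the simply typed $\lambda$-calculus modulo $\approx$ is strongly normalizing: if $\Gamma \vdash M : T$ for some context $\Gamma$ and some type $T$, then there is no infinite $\rhd$-reduction sequence starting from $M$.
   Context: Terms. Let $\mathcal{V}$ be an infinite set of variables. $\lambda$-terms are given by $\mathcal{M} ::= \mathcal{V} \mid \lambda \mathcal{V}\,\mathcal{M} \mid (\mathcal{M}\;\mathcal{M})$, up to renaming of bound variables. The relation $\rhd$ is the least relation on terms compatible with contexts (i.e. reduction is allowed in any subterm) containing $(\lambda x\, M\; N) \rhd M[x:=N]$. Types. Let $\mathcal{A}$ be a set of atomic constants and $\mathcal{X}=\{X_i : i\in I\}$ a set of type variables. Types are given by $\mathcal{T} ::= \mathcal{A} \mid \mathcal{X} \mid \mathcal{T}\to\mathcal{T}$. Given types $F_i$ ($i \in I$), the congruence $\approx$ generated by $E=\{F_i : i\in I\}$ is the least congruence on $\mathcal{T}$ (equivalence relation compatible with $\to$) such that $X_i\approx F_i$ for each $i\in I$. Polarity. For $X\in\mathcal{X}$, the sets $\mathcal{T}^+(X),\mathcal{T}^-(X)\subseteq\mathcal{T}$ are defined inductively by: $X\in\mathcal{T}^+(X)$; if $U\in(\mathcal{X}\setminus\{X\})\cup\mathcal{A}$ then $U\in\mathcal{T}^+(X)\cap\mathcal{T}^-(X)$; if $U\in\mathcal{T}^-(X)$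 and $V\in\mathcal{T}^+(X)$, then $U\to V\in\mathcal{T}^+(X)$ and $V\to U\in\mathcal{T}^-(X)$. The congruence $\approx$ is good if, for each $X\in\mathcal{X}$ and each type $T$, $X\approx T$ implies $T\in\mathcal{T}^+(X)$. Typing rules ($\Gamma$ is a context, i.e. a set of declarations $x:U$ with $x \in \mathcal{V}$, $U\in\mathcal{T}$): (ax) $\Gamma,x:U\vdash x:U$; ($\approx$) from $\Gamma\vdash M:U$ and $U\approx V$ infer $\Gamma\vdash M:V$; ($\to_i$) from $\Gamma,x:U\vdash M:V$ infer $\Gamma\vdash\lambda x\,M:U\to V$; ($\to_e$) from $\Gamma\vdash M_1:U\to V$ and $\Gamma\vdash M_2:U$ infer $\Gamma\vdash(M_1\;M_2):V$. -}

module Defs where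

open import Level using (Level; _⊔_)
open import Data.Nat.Base using (ℕ; zero; suc)
open import Data.Fin.Base using (Fin; zero; suc)
open import Data.Vec.Base using (Vec; _∷_; lookup)
open import Data.Product.Base using (∃)
open import Function.Base using (flip)
open import Induction.InfiniteDescent using (InfiniteDescendingSequenceFrom)
open import Relation.Binary.PropositionalEquality.Core using (_≢_)
open import Relation.Nullary.Negation.Core using (¬_)

-- λ-terms up to renaming of bound variables: well-scoped de Bruijn syntax,
-- where Term n has its free variables among n given ones.
infixl 7 _·_

data Term (n : ℕ) : Set where
  var : Fin n → Term n
  ƛ_  : Term (suc n) → Term n
  _·_ : Term n → Term n → Term n

Ren : ℕ → ℕ → Set
Ren m n = Fin m → Fin n

Sub : ℕ → ℕ → Set
Sub m n = Fin m → Term n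

liftRen : ∀ {m n} → Ren m n → Ren (suc m) (suc n)
liftRen ρ zero    = zero
liftRen ρ (suc x) = suc (ρ x)

rename : ∀ {m n} → Ren m n → Term m → Term n
rename ρ (var x) = var (ρ x)
rename ρ (ƛ M)   = ƛ rename (liftRen ρ) M
rename ρ (M · N) = rename ρ M · rename ρ N

liftSub : ∀ {m n} → Sub m n → Sub (suc m) (suc n)
liftSub σ zero    = var zero
liftSub σ (suc x) = rename suc (σ x)

subst : ∀ {m n} → Sub m n → Term m → Term n
subst σ (var x) = σ x
subst σ (ƛ M)   = ƛ subst (liftSub σ) M
subst σ (M · N) = subst σ M · subst σ N

singleSub : ∀ {n} → Term n → Sub (suc n) n
singleSub N zero    = N
singleSub N (suc x) = var x

_[_] : ∀ {n} → Term (suc n) → Term n → Term n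
M [ N ] = subst (singleSub N) M

infix 4 _▷_

data _▷_ {n : ℕ} : Term n → Term n → Set where
  β  : ∀ {M N} → (ƛ M) · N ▷ M [ N ]
  ξ  : ∀ {M M′} → M ▷ M′ → ƛ M ▷ ƛ M′
  ·ˡ : ∀ {M M′ N} → M ▷ M′ → M · N ▷ M′ · N
  ·ʳ : ∀ {M N N′} → N ▷ N′ → M · N ▷ M · N′

-- The negative formulation of strong normalization; constructively, it is
-- implied by accessibility of M for the converse of _▷_.
StronglyNormalizing : ∀ {n} → Term n → Set
StronglyNormalizing M = ¬ ∃ λ f → InfiniteDescendingSequenceFrom (flip _▷_) f M

-- A is the set of atomic constants; the type variables X_i are indexed by I.
infixr 6 _⇒_

data Ty {a ι : Level} (A : Set a) (I : Set ι) : Set (a ⊔ ι) where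
  atom : A → Ty A I
  tvar : I → Ty A I
  _⇒_  : Ty A I → Ty A I → Ty A I

module _ {a ι : Level} {A : Set a} {I : Set ι} where

  infix 4 _⊢_≈_ _∣_⊢_⦂_

  data _⊢_≈_ (F : I → Ty A I) : Ty A I → Ty A I → Set (a ⊔ ι) where
    eqn    : ∀ i → F ⊢ tvar i ≈ F i
    ≈refl  : ∀ {U} → F ⊢ U ≈ U
    ≈sym   : ∀ {U V} → F ⊢ U ≈ V → F ⊢ V ≈ U
    ≈trans : ∀ {U V W} → F ⊢ U ≈ V → F ⊢ V ≈ W → F ⊢ U ≈ W
    ≈cong  : ∀ {U U′ V V′} → F ⊢ U ≈ U′ → F ⊢ V ≈ V′ → F ⊢ U ⇒ V ≈ U′ ⇒ V′

  mutual
    data Pos (X : I) : Ty A I → Set (a ⊔ ι) where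
      self  : Pos X (tvar X)
      other : ∀ {Y} → Y ≢ X → Pos X (tvar Y)
      atom  : ∀ {c} → Pos X (atom c)
      _⇒_   : ∀ {U V} → Neg X U → Pos X V → Pos X (U ⇒ V)

    data Neg (X : I) : Ty A I → Set (a ⊔ ι) where
      other : ∀ {Y} → Y ≢ X → Neg X (tvar Y)
      atom  : ∀ {c} → Neg X (atom c)
      _⇒_   : ∀ {U V} → Pos X U → Neg X V → Neg X (U ⇒ V)

  Good : (I → Ty A I) → Set (a ⊔ ι)
  Good F = ∀ X T → F ⊢ tvar X ≈ T → Pos X T

  -- A context declares exactly one type for each variable in scope.
  data _∣_⊢_⦂_ (F : I → Ty A I) {n : ℕ} (Γ : Vec (Ty A I) n) :
               Term n → Ty A I → Set (a ⊔ ι) where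
    ax   : ∀ x → F ∣ Γ ⊢ var x ⦂ lookup Γ x
    conv : ∀ {M U V} → F ∣ Γ ⊢ M ⦂ U → F ⊢ U ≈ V → F ∣ Γ ⊢ M ⦂ V
    lam  : ∀ {M U V} → F ∣ U ∷ Γ ⊢ M ⦂ V → F ∣ Γ ⊢ ƛ M ⦂ U ⇒ V
    app  : ∀ {M N U V} → F ∣ Γ ⊢ M ⦂ U ⇒ V → F ∣ Γ ⊢ N ⦂ U → F ∣ Γ ⊢ M · N ⦂ V

{-# OPTIONS --safe #-}

-- Record as nodes the finitely many types occurring in a typing derivation, with an edge from
-- T to U (negative) and to V (positive) whenever T ≈ U ⇒ V.  Since _⊢_≈_ is injective on arrows,
-- a negative cycle would make some T a negative subterm of a type ≈ T; rotating it down T to a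
-- variable contradicts goodness.  So "reachable from s by both a positive and a negative path"
-- is a strict order ≺ on nodes, well-founded by finiteness.  By ≺-induction on s, strongly
-- normalizing terms of type s may be applied to strongly normalizing arguments: substitute such
-- arguments only for variables of types negatively reachable from s, and induct on the inductive
-- characterization of strong normalization of a term of a type t positively reachable from s.
-- If its head is a substituted variable, then t is also negatively reachable, so t ≺ s.

module Submission where

open import Defs
open import Level using (Level; _⊔_)
open import Data.Nat.Base using (ℕ; zero; suc)
open import Data.Fin.Base using (Fin; zero; suc)
open import Data.Fin.Induction using (spo-wellFounded)
open import Data.List.Base as List using (List; []; _∷_; _++_)
open import Data.List.Membership.Propositional.Properties using (∈-tabulate⁺)
open import Data.List.Relation.Unary.All as All using (All; []; _∷_)
open import Data.List.Relation.Unary.All.Properties using (++⁻ˡ; ++⁻ʳ)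
open import Data.List.Relation.Unary.Any using (index)
open import Data.List.Relation.Unary.Any.Properties using (lookup-index)
open import Data.Product.Base using (∃; ∃₂; _×_; _,_; proj₁; proj₂)
open import Data.Sign.Base using (Sign; +; -; opposite)
open import Data.Sum.Base using (_⊎_; inj₁; inj₂)
open import Data.Vec.Base using (Vec; lookup)
open import Data.Vec.Functional as Functional using ()
open import Function.Base using (_∘_; id; flip)
open import Induction.WellFounded as WF using (Acc; acc; WellFounded)
open import Relation.Binary.Construct.Closure.ReflexiveTransitive using (Star; ε; _◅_; _◅◅_; gmap)
open import Relation.Binary.PropositionalEquality as ≡ using (_≡_; refl; sym; trans; cong; cong₂)
open import Relation.Nullary.Negation.Core using (¬_; contradiction)

-- Type equations

module _ {a ι : Level} {A : Set a} {I : Set ι} where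

  -- Signed occurrences of an arbitrary type, whereas `Pos` and `Neg` concern variables: an
  -- occurrence of an arrow can thus be passed down to its components.
  data Occurs : Sign → Ty A I → Ty A I → Set (a ⊔ ι) where
    here : ∀ {T} → Occurs + T T
    dom  : ∀ {p T U V} → Occurs p T U → Occurs (opposite p) T (U ⇒ V)
    cod  : ∀ {p T U V} → Occurs p T V → Occurs p T (U ⇒ V)

  Occurs-dom : ∀ {p U V D} → Occurs p (U ⇒ V) D → Occurs (opposite p) U D
  Occurs-dom here    = dom here
  Occurs-dom (dom o) = dom (Occurs-dom o)
  Occurs-dom (cod o) = cod (Occurs-dom o)

  Occurs-cod : ∀ {p U V D} → Occurs p (U ⇒ V) D → Occurs p V D
  Occurs-cod here    = cod here
  Occurs-cod (dom o) = dom (Occurs-cod o)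
  Occurs-cod (cod o) = cod (Occurs-cod o)

  -- The sign is a variable constrained by an equation, since opposite p does not unify with a sign.
  mutual
    Pos⇒¬Occurs- : ∀ {p X D} → p ≡ - → Pos X D → ¬ Occurs p (tvar X) D
    Pos⇒¬Occurs- ()   _       here
    Pos⇒¬Occurs- eq   (u ⇒ v) (cod o)       = Pos⇒¬Occurs- eq v o
    Pos⇒¬Occurs- eq   (u ⇒ v) (dom {+} o)   = Neg⇒¬Occurs+ refl u o
    Pos⇒¬Occurs- ()   (u ⇒ v) (dom { - } o)

    Neg⇒¬Occurs+ : ∀ {p X D} → p ≡ + → Neg X D → ¬ Occurs p (tvar X) D
    Neg⇒¬Occurs+ _    (other X≢X) here          = contradiction refl X≢X
    Neg⇒¬Occurs+ eq   (u ⇒ v)     (cod o)       = Neg⇒¬Occurs+ eq v o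
    Neg⇒¬Occurs+ ()   (u ⇒ v)     (dom {+} o)
    Neg⇒¬Occurs+ eq   (u ⇒ v)     (dom { - } o) = Pos⇒¬Occurs- refl u o

module _ {a ι : Level} {A : Set a} {I : Set ι} (F : I → Ty A I) where

  -- Confluence of unfolding and injectivity of arrows

  infix 4 _⇛_ _⇛*_

  -- Parallel unfolding of any set of variable occurrences, which has the diamond property because
  -- each variable has a single unfolding.
  data _⇛_ : Ty A I → Ty A I → Set (a ⊔ ι) where
    stay   : ∀ {U} → U ⇛ U
    unfold : ∀ i → tvar i ⇛ F i
    _⇒_    : ∀ {U U′ V V′} → U ⇛ U′ → V ⇛ V′ → U ⇒ V ⇛ U′ ⇒ V′

  _⇛*_ : Ty A I → Ty A I → Set (a ⊔ ι)
  _⇛*_ = Star _⇛_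

  ⇛-diamond : ∀ {T U V} → T ⇛ U → T ⇛ V → ∃ λ W → U ⇛ W × V ⇛ W
  ⇛-diamond stay       q          = _ , q , stay
  ⇛-diamond p          stay       = _ , stay , p
  ⇛-diamond (unfold i) (unfold i) = _ , stay , stay
  ⇛-diamond (p ⇒ p′)   (q ⇒ q′)
    with _ , r , s ← ⇛-diamond p q | _ , r′ , s′ ← ⇛-diamond p′ q′
    = _ , r ⇒ r′ , s ⇒ s′

  ⇛-strip : ∀ {T U V} → T ⇛ U → T ⇛* V → ∃ λ W → U ⇛* W × V ⇛ W
  ⇛-strip p ε = _ , ε , p
  ⇛-strip p (q ◅ qs)
    with _ , r , s ← ⇛-diamond p q
    with _ , rs , s′ ← ⇛-strip s qs
    = _ , r ◅ rs , s′

  ⇛*-confluent : ∀ {T U V} → T ⇛* U → T ⇛* V → ∃ λ W → U ⇛* W × V ⇛* W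
  ⇛*-confluent ε qs = _ , qs , ε
  ⇛*-confluent (p ◅ ps) qs
    with _ , rs , s ← ⇛-strip p qs
    with _ , rs′ , ss ← ⇛*-confluent ps rs
    = _ , rs′ , s ◅ ss

  ≈⇒joinable : ∀ {U V} → F ⊢ U ≈ V → ∃ λ W → U ⇛* W × V ⇛* W
  ≈⇒joinable (eqn i) = _ , unfold i ◅ ε , ε
  ≈⇒joinable ≈refl   = _ , ε , ε
  ≈⇒joinable (≈sym p) with _ , r , s ← ≈⇒joinable p = _ , s , r
  ≈⇒joinable (≈trans p q)
    with _ , r , s ← ≈⇒joinable p | _ , r′ , s′ ← ≈⇒joinable q
    with _ , t , t′ ← ⇛*-confluent s r′
    = _ , r ◅◅ t , s′ ◅◅ t′
  ≈⇒joinable (≈cong p q)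
    with _ , r , s ← ≈⇒joinable p | _ , r′ , s′ ← ≈⇒joinable q
    = _ , ⇒⁺ r r′ , ⇒⁺ s s′
    where
    ⇒⁺ : ∀ {U U′ V V′} → U ⇛* U′ → V ⇛* V′ → U ⇒ V ⇛* U′ ⇒ V′
    ⇒⁺ us vs = gmap (_⇒ _) (_⇒ stay) us ◅◅ gmap (_ ⇒_) (stay ⇒_) vs

  ⇛⇒≈ : ∀ {U V} → U ⇛ V → F ⊢ U ≈ V
  ⇛⇒≈ stay       = ≈refl
  ⇛⇒≈ (unfold i) = eqn i
  ⇛⇒≈ (p ⇒ q)    = ≈cong (⇛⇒≈ p) (⇛⇒≈ q)

  arrow-reduct : ∀ {U V W} → U ⇒ V ⇛* W →
                 ∃₂ λ U′ V′ → W ≡ U′ ⇒ V′ × F ⊢ U ≈ U′ × F ⊢ V ≈ V′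
  arrow-reduct ε           = _ , _ , refl , ≈refl , ≈refl
  arrow-reduct (stay ◅ rs) = arrow-reduct rs
  arrow-reduct (p ⇒ q ◅ rs)
    with _ , _ , eq , r , s ← arrow-reduct rs
    = _ , _ , eq , ≈trans (⇛⇒≈ p) r , ≈trans (⇛⇒≈ q) s

  atom-reduct : ∀ {c W} → atom c ⇛* W → W ≡ atom c
  atom-reduct ε           = refl
  atom-reduct (stay ◅ rs) = atom-reduct rs

  -- By confluence the two arrows have a common reduct. Unfolding acts only inside the components of
  -- an arrow, so this reduct is an arrow whose components link theirs.
  ⇒-injective : ∀ {U V U′ V′} → F ⊢ U ⇒ V ≈ U′ ⇒ V′ → F ⊢ U ≈ U′ × F ⊢ V ≈ V′
  ⇒-injective p
    with _ , rs , ss ← ≈⇒joinable p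
    with _ , _ , refl , u , v ← arrow-reduct rs
    with _ , _ , refl , u′ , v′ ← arrow-reduct ss
    = ≈trans u (≈sym u′) , ≈trans v (≈sym v′)

  atom≉⇒ : ∀ {c U V} → ¬ (F ⊢ atom c ≈ U ⇒ V)
  atom≉⇒ p
    with _ , rs , ss ← ≈⇒joinable p
    with refl ← atom-reduct rs
    with _ , _ , () , _ ← arrow-reduct ss

  Occurs-replace : ∀ {p T T′ D} → Occurs p T D → F ⊢ T ≈ T′ →
                   ∃ λ D′ → F ⊢ D ≈ D′ × Occurs p T′ D′
  Occurs-replace here e = _ , e , here
  Occurs-replace (dom o) e
    with _ , e′ , o′ ← Occurs-replace o e = _ , ≈cong e′ ≈refl , dom o′
  Occurs-replace (cod o) e
    with _ , e′ , o′ ← Occurs-replace o e = _ , ≈cong ≈refl e′ , cod o′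

  -- Induction on `T`. A negative occurrence is proper, so `D` is an arrow. If `T` is an arrow too,
  -- passing to the component of both types that contains the occurrence keeps the sign: the outer
  -- edge removed and the inner edge added have the same polarity. A variable contradicts goodness,
  -- and an atom is congruent to no arrow.
  no-negative-self-occurrence : Good F → ∀ T {D p} → p ≡ - → F ⊢ T ≈ D → ¬ Occurs p T D
  no-negative-self-occurrence good T () e here
  no-negative-self-occurrence good (atom c) _ e (dom o) = atom≉⇒ e
  no-negative-self-occurrence good (atom c) _ e (cod o) = atom≉⇒ e
  no-negative-self-occurrence good (tvar X) eq e o@(dom _) = Pos⇒¬Occurs- eq (good X _ e) o
  no-negative-self-occurrence good (tvar X) eq e o@(cod _) = Pos⇒¬Occurs- eq (good X _ e) o
  no-negative-self-occurrence good (U ⇒ V) eq e (dom o) =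
    no-negative-self-occurrence good U eq (proj₁ (⇒-injective e)) (Occurs-dom o)
  no-negative-self-occurrence good (U ⇒ V) eq e (cod o) =
    no-negative-self-occurrence good V eq (proj₂ (⇒-injective e)) (Occurs-cod o)

-- Renaming and substitution

rename-id : ∀ {n} {ρ : Ren n n} → (∀ x → ρ x ≡ x) → ∀ M → rename ρ M ≡ M
rename-id h (var x) = cong var (h x)
rename-id h (ƛ M)   = cong ƛ_ (rename-id (λ { zero → refl ; (suc x) → cong suc (h x) }) M)
rename-id h (M · N) = cong₂ _·_ (rename-id h M) (rename-id h N)

subst-id : ∀ {n} {σ : Sub n n} → (∀ x → σ x ≡ var x) → ∀ M → subst σ M ≡ M
subst-id h (var x) = h x
subst-id h (ƛ M)   =
  cong ƛ_ (subst-id (λ { zero → refl ; (suc x) → cong (rename suc) (h x) }) M)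
subst-id h (M · N) = cong₂ _·_ (subst-id h M) (subst-id h N)

rename-rename : ∀ {k m n} {ρ : Ren k m} {ρ′ : Ren m n} {ρ″ : Ren k n} →
                (∀ x → ρ′ (ρ x) ≡ ρ″ x) → ∀ M → rename ρ′ (rename ρ M) ≡ rename ρ″ M
rename-rename h (var x) = cong var (h x)
rename-rename h (ƛ M)   =
  cong ƛ_ (rename-rename (λ { zero → refl ; (suc x) → cong suc (h x) }) M)
rename-rename h (M · N) = cong₂ _·_ (rename-rename h M) (rename-rename h N)

subst-rename : ∀ {k m n} {ρ : Ren k m} {σ : Sub m n} {τ : Sub k n} →
               (∀ x → σ (ρ x) ≡ τ x) → ∀ M → subst σ (rename ρ M) ≡ subst τ M
subst-rename h (var x) = h x
subst-rename h (ƛ M)   =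
  cong ƛ_ (subst-rename (λ { zero → refl ; (suc x) → cong (rename suc) (h x) }) M)
subst-rename h (M · N) = cong₂ _·_ (subst-rename h M) (subst-rename h N)

rename-subst : ∀ {k m n} {σ : Sub k m} {ρ : Ren m n} {τ : Sub k n} →
               (∀ x → rename ρ (σ x) ≡ τ x) → ∀ M → rename ρ (subst σ M) ≡ subst τ M
rename-subst h (var x) = h x
rename-subst {σ = σ} {ρ} h (ƛ M) = cong ƛ_ (rename-subst h′ M)
  where
  h′ : ∀ x → rename (liftRen ρ) (liftSub σ x) ≡ liftSub _ x
  h′ zero    = refl
  h′ (suc x) = trans (rename-rename (λ _ → refl) (σ x))
                 (trans (sym (rename-rename (λ _ → refl) (σ x))) (cong (rename suc) (h x)))
rename-subst h (M · N) = cong₂ _·_ (rename-subst h M) (rename-subst h N)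

subst-subst : ∀ {k m n} {σ : Sub k m} {σ′ : Sub m n} {τ : Sub k n} →
              (∀ x → subst σ′ (σ x) ≡ τ x) → ∀ M → subst σ′ (subst σ M) ≡ subst τ M
subst-subst h (var x) = h x
subst-subst {σ = σ} {σ′} h (ƛ M) = cong ƛ_ (subst-subst h′ M)
  where
  h′ : ∀ x → subst (liftSub σ′) (liftSub σ x) ≡ liftSub _ x
  h′ zero    = refl
  h′ (suc x) = trans (subst-rename (λ _ → refl) (σ x))
                 (trans (sym (rename-subst (λ _ → refl) (σ x))) (cong (rename suc) (h x)))
subst-subst h (M · N) = cong₂ _·_ (subst-subst h M) (subst-subst h N)

infixr 5 _∷ˢ_

_∷ˢ_ : ∀ {m n} → Term n → Sub m n → Sub (suc m) n
_∷ˢ_ = Functional._∷_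

-- Lets a contraction extend the current substitution by one entry.
subst-liftSub-[] : ∀ {m n} (σ : Sub m n) M N → subst (liftSub σ) M [ N ] ≡ subst (N ∷ˢ σ) M
subst-liftSub-[] σ M N = subst-subst
  (λ { zero → refl
     ; (suc x) → trans (subst-rename (λ _ → refl) (σ x)) (subst-id (λ _ → refl) (σ x)) })
  M

subst-[] : ∀ {m n} (σ : Sub m n) M N →
           subst (liftSub σ) M [ subst σ N ] ≡ subst σ (M [ N ])
subst-[] σ M N = trans (subst-liftSub-[] σ M (subst σ N))
  (sym (subst-subst (λ { zero → refl ; (suc x) → refl }) M))

rename-[] : ∀ {m n} (ρ : Ren m n) M N →
            rename (liftRen ρ) M [ rename ρ N ] ≡ rename ρ (M [ N ])
rename-[] ρ M N = trans
  (subst-rename {τ = rename ρ N ∷ˢ (var ∘ ρ)} (λ { zero → refl ; (suc x) → refl }) M)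
  (sym (rename-subst (λ { zero → refl ; (suc x) → refl }) M))

-- Reduction

infix 4 _▷*_

_▷*_ : ∀ {n} → Term n → Term n → Set
_▷*_ = Star _▷_

β-≡ : ∀ {n} {M : Term (suc n)} {N K} → M [ N ] ≡ K → (ƛ M) · N ▷ K
β-≡ refl = β

rename-▷ : ∀ {m n} (ρ : Ren m n) {M M′} → M ▷ M′ → rename ρ M ▷ rename ρ M′
rename-▷ ρ (β {M} {N}) = β-≡ (rename-[] ρ M N)
rename-▷ ρ (ξ r)       = ξ (rename-▷ (liftRen ρ) r)
rename-▷ ρ (·ˡ r)      = ·ˡ (rename-▷ ρ r)
rename-▷ ρ (·ʳ r)      = ·ʳ (rename-▷ ρ r)

subst-▷ : ∀ {m n} (σ : Sub m n) {M M′} → M ▷ M′ → subst σ M ▷ subst σ M′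
subst-▷ σ (β {M} {N}) = β-≡ (subst-[] σ M N)
subst-▷ σ (ξ r)       = ξ (subst-▷ (liftSub σ) r)
subst-▷ σ (·ˡ r)      = ·ˡ (subst-▷ σ r)
subst-▷ σ (·ʳ r)      = ·ʳ (subst-▷ σ r)

subst-▷* : ∀ {m n} {σ τ : Sub m n} → (∀ x → σ x ▷* τ x) → ∀ M → subst σ M ▷* subst τ M
subst-▷* h (var x) = h x
subst-▷* h (ƛ M)   = gmap ƛ_ ξ
  (subst-▷* (λ { zero → ε ; (suc x) → gmap (rename suc) (rename-▷ suc) (h x) }) M)
subst-▷* h (M · N) = gmap (_· _) ·ˡ (subst-▷* h M) ◅◅ gmap (_ ·_) ·ʳ (subst-▷* h N)

infix 4 _⟶[_]_

-- The index N is the argument of the contracted redex: contraction may erase it, so that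
-- expansion preserves strong normalization only if N is strongly normalizing.
data _⟶[_]_ {n : ℕ} : Term n → Term n → Term n → Set where
  β  : ∀ {M N} → (ƛ M) · N ⟶[ N ] M [ N ]
  ·ˡ : ∀ {M M′ N P} → M ⟶[ N ] M′ → M · P ⟶[ N ] M′ · P

⟶-≡ : ∀ {n} {M N K K′ : Term n} → M ⟶[ N ] K → K ≡ K′ → M ⟶[ N ] K′
⟶-≡ h refl = h

rename-⟶ : ∀ {m n} (ρ : Ren m n) {M N M′} →
           M ⟶[ N ] M′ → rename ρ M ⟶[ rename ρ N ] rename ρ M′
rename-⟶ ρ (β {M} {N}) = ⟶-≡ β (rename-[] ρ M N)
rename-⟶ ρ (·ˡ h)      = ·ˡ (rename-⟶ ρ h)

subst-⟶ : ∀ {m n} (σ : Sub m n) {M N M′} →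
          M ⟶[ N ] M′ → subst σ M ⟶[ subst σ N ] subst σ M′
subst-⟶ σ (β {M} {N}) = ⟶-≡ β (subst-[] σ M N)
subst-⟶ σ (·ˡ h)      = ·ˡ (subst-⟶ σ h)

-- The inductive characterization of strong normalization by neutral terms, abstractions and weak
-- head expansions. Recursion on it exposes the head of a term.
mutual
  data SN {n : ℕ} : Term n → Set where
    neutral : ∀ {M} → SNe M → SN M
    ƛ_      : ∀ {M} → SN M → SN (ƛ M)
    expand  : ∀ {M N M′} → M ⟶[ N ] M′ → SN N → SN M′ → SN M

  data SNe {n : ℕ} : Term n → Set where
    var : ∀ x → SNe (var x)
    _·_ : ∀ {M N} → SNe M → SN N → SNe (M · N)

mutual
  rename-SN : ∀ {m n} (ρ : Ren m n) {M} → SN M → SN (rename ρ M)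
  rename-SN ρ (neutral ne)   = neutral (rename-SNe ρ ne)
  rename-SN ρ (ƛ sn)         = ƛ rename-SN (liftRen ρ) sn
  rename-SN ρ (expand h n m) = expand (rename-⟶ ρ h) (rename-SN ρ n) (rename-SN ρ m)

  rename-SNe : ∀ {m n} (ρ : Ren m n) {M} → SNe M → SNe (rename ρ M)
  rename-SNe ρ (var x)   = var (ρ x)
  rename-SNe ρ (ne · sn) = rename-SNe ρ ne · rename-SN ρ sn

-- Inductive strong normalization implies accessibility

Halts : ∀ {n} → Term n → Set
Halts = Acc (flip _▷_)

Halts-▷* : ∀ {n} {M M′ : Term n} → M ▷* M′ → Halts M → Halts M′
Halts-▷* ε        h       = h
Halts-▷* (r ◅ rs) (acc h) = Halts-▷* rs (h r)

-- How an arbitrary step meets a weak head contraction. A step inside the argument of the redex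
-- needs `▷*` on the other side, since contraction may copy or erase the argument.
data Residual {n : ℕ} (N M′ K : Term n) : Set where
  contracted : K ≡ M′ → Residual N M′ K
  elsewhere  : ∀ {K′} → K ⟶[ N ] K′ → M′ ▷ K′ → Residual N M′ K
  argument   : ∀ {N′ K′} → N ▷ N′ → K ⟶[ N′ ] K′ → M′ ▷* K′ → Residual N M′ K

residual : ∀ {n} {M N M′ K : Term n} → M ⟶[ N ] M′ → M ▷ K → Residual N M′ K
residual β           β          = contracted refl
residual (β {N = N}) (·ˡ (ξ r)) = elsewhere β (subst-▷ (singleSub N) r)
residual (β {M})     (·ʳ r)     =
  argument r β (subst-▷* (λ { zero → r ◅ ε ; (suc x) → ε }) M)
residual (·ˡ h)      (·ʳ r)     = elsewhere (·ˡ h) (·ʳ r)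
residual (·ˡ h)      (·ˡ r)     with residual h r
... | contracted refl  = contracted refl
... | elsewhere h′ r′   = elsewhere (·ˡ h′) (·ˡ r′)
... | argument n h′ rs = argument n (·ˡ h′) (gmap (_· _) ·ˡ rs)

-- Lexicographic induction, on `Halts N` first: a step in the argument shrinks `N`, while `M′` may
-- not move at all; a step elsewhere keeps `N` and shrinks `M′`.
mutual
  Halts-expand : ∀ {n} {M N M′ : Term n} → Halts N → Halts M′ → M ⟶[ N ] M′ → Halts M
  Halts-expand n m h = acc λ r → Halts-residual n m (residual h r)

  Halts-residual : ∀ {n} {N M′ K : Term n} → Halts N → Halts M′ → Residual N M′ K → Halts K
  Halts-residual n       m       (contracted refl)  = m
  Halts-residual n       (acc m) (elsewhere h r)    = Halts-expand n (m r) h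
  Halts-residual (acc n) m       (argument r h rs) = Halts-expand (n r) (Halts-▷* rs m) h

Halts-ƛ : ∀ {n} {M : Term (suc n)} → Halts M → Halts (ƛ M)
Halts-ƛ (acc m) = acc λ { (ξ r) → Halts-ƛ (m r) }

data Neutral {n : ℕ} : Term n → Set where
  var : ∀ x → Neutral (var x)
  _·_ : ∀ {M} → Neutral M → ∀ N → Neutral (M · N)

Neutral-▷ : ∀ {n} {M M′ : Term n} → Neutral M → M ▷ M′ → Neutral M′
Neutral-▷ (ne · N) (·ˡ r) = Neutral-▷ ne r · N
Neutral-▷ (ne · N) (·ʳ r) = ne · _

SNe⇒Neutral : ∀ {n} {M : Term n} → SNe M → Neutral M
SNe⇒Neutral (var x)  = var x
SNe⇒Neutral (ne · _) = SNe⇒Neutral ne · _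

-- A neutral head never becomes an abstraction, so every step stays inside one of the two sides.
Halts-· : ∀ {n} {M N : Term n} → Neutral M → Halts M → Halts N → Halts (M · N)
Halts-· {n} {M} {N} ne hm hn = acc (go ne hm hn)
  where
  go : ∀ {M N : Term n} → Neutral M → Halts M → Halts N → ∀ {K} → M · N ▷ K → Halts K
  go ne (acc m) hn      (·ˡ r) = Halts-· (Neutral-▷ ne r) (m r) hn
  go ne hm      (acc k) (·ʳ r) = Halts-· ne hm (k r)

mutual
  SN⇒Halts : ∀ {n} {M : Term n} → SN M → Halts M
  SN⇒Halts (neutral ne)   = SNe⇒Halts ne
  SN⇒Halts (ƛ sn)         = Halts-ƛ (SN⇒Halts sn)
  SN⇒Halts (expand h n m) = Halts-expand (SN⇒Halts n) (SN⇒Halts m) h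

  SNe⇒Halts : ∀ {n} {M : Term n} → SNe M → Halts M
  SNe⇒Halts (var x)   = acc λ ()
  SNe⇒Halts (ne · sn) = Halts-· (SNe⇒Neutral ne) (SNe⇒Halts ne) (SN⇒Halts sn)

Halts⇒StronglyNormalizing : ∀ {n} {M : Term n} → Halts M → StronglyNormalizing M
Halts⇒StronglyNormalizing (acc h) (f , refl , d) =
  Halts⇒StronglyNormalizing (h (d 0)) (f ∘ suc , refl , d ∘ suc)

-- Typing by the nodes of a finite type graph

module Graph {a ι : Level} {A : Set a} {I : Set ι} (F : I → Ty A I) (good : Good F)
             {size : ℕ} (ty : Fin size → Ty A I) where

  Node : Set
  Node = Fin size

  infix 4 _≃_

  _≃_ : Node → Node → Set (a ⊔ ι)
  s ≃ t = F ⊢ ty s ≈ ty t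

  Arrow : Node → Node → Node → Set (a ⊔ ι)
  Arrow s u v = F ⊢ ty s ≈ ty u ⇒ ty v

  Arrow-injective : ∀ {s u v u′ v′} → Arrow s u v → Arrow s u′ v′ → u ≃ u′ × v ≃ v′
  Arrow-injective e e′ = ⇒-injective F (≈trans (≈sym e) e′)

  -- The sign is the parity of the number of `dom` edges. Congruent types may belong to several
  -- nodes, between which `done` and the edges do not distinguish.
  data Path (s : Node) : Sign → Node → Set (a ⊔ ι) where
    done : ∀ {t} → s ≃ t → Path s + t
    dom  : ∀ {p t u v} → Path s p t → Arrow t u v → Path s (opposite p) u
    cod  : ∀ {p t u v} → Path s p t → Arrow t u v → Path s p v

  Path-conv : ∀ {p s t t′} → Path s p t → t ≃ t′ → Path s p t′
  Path-conv (done e)  e′ = done (≈trans e e′)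
  Path-conv (dom π e) e′ = dom π (≈trans e (≈cong e′ ≈refl))
  Path-conv (cod π e) e′ = cod π (≈trans e (≈cong ≈refl e′))

  Path-trans : ∀ {p s t r} → Path s + t → Path t p r → Path s p r
  Path-trans π (done e)   = Path-conv π e
  Path-trans π (dom π′ e) = dom (Path-trans π π′) e
  Path-trans π (cod π′ e) = cod (Path-trans π π′) e

  -- Unrolls the path into a single type: each edge replaces the occurrence reached so far by a
  -- congruent arrow and descends into it.
  Path⇒Occurs : ∀ {p s t} → Path s p t → ∃ λ D → F ⊢ ty s ≈ D × Occurs p (ty t) D
  Path⇒Occurs (done e) = _ , e , here
  Path⇒Occurs (dom π e)
    with _ , e₁ , o ← Path⇒Occurs π
    with _ , e₂ , o′ ← Occurs-replace F o e
    = _ , ≈trans e₁ e₂ , Occurs-dom o′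
  Path⇒Occurs (cod π e)
    with _ , e₁ , o ← Path⇒Occurs π
    with _ , e₂ , o′ ← Occurs-replace F o e
    = _ , ≈trans e₁ e₂ , Occurs-cod o′

  no-negative-cycle : ∀ {s} → ¬ Path s - s
  no-negative-cycle π with _ , e , o ← Path⇒Occurs π =
    no-negative-self-occurrence F good _ refl e o

  infix 4 _≺_

  _≺_ : Node → Node → Set (a ⊔ ι)
  t ≺ s = Path s + t × Path s - t

  ≺-wellFounded : WellFounded _≺_
  ≺-wellFounded = spo-wellFounded record
    { isEquivalence = ≡.isEquivalence
    ; irrefl        = λ { refl (_ , π) → no-negative-cycle π }
    -- The positive path to the middle node is prefixed to both paths out of it, which keeps their
    -- signs.
    ; trans         = λ { (π⁺ , π⁻) (π , _) → Path-trans π π⁺ , Path-trans π π⁻ }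
    ; <-resp-≈      = ≡.resp₂ _≺_
    }

  -- Typing by nodes and weak head subject reduction

  Ctx : ℕ → Set
  Ctx n = Fin n → Node

  infixr 5 _▸_

  _▸_ : ∀ {n} → Node → Ctx n → Ctx (suc n)
  _▸_ = Functional._∷_

  infix 4 _⊩_∶_

  -- Syntax-directed, with conversion absorbed by `≃` and `Arrow`. All types being nodes, weak head
  -- reducts stay typed in the same finite graph.
  data _⊩_∶_ {n : ℕ} (Γ : Ctx n) : Term n → Node → Set (a ⊔ ι) where
    var : ∀ {x t} → Γ x ≃ t → Γ ⊩ var x ∶ t
    lam : ∀ {M t u v} → Arrow t u v → u ▸ Γ ⊩ M ∶ v → Γ ⊩ ƛ M ∶ t
    app : ∀ {M N t u v} → Arrow t u v → Γ ⊩ M ∶ t → Γ ⊩ N ∶ u → Γ ⊩ M · N ∶ v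

  conv-⊩ : ∀ {n} {Γ : Ctx n} {M t t′} → t ≃ t′ → Γ ⊩ M ∶ t → Γ ⊩ M ∶ t′
  conv-⊩ e (var e′)     = var (≈trans e′ e)
  conv-⊩ e (lam e′ d)   = lam (≈trans (≈sym e) e′) d
  conv-⊩ e (app e′ d d′) = app (≈trans e′ (≈cong ≈refl e)) d d′

  TypedRen : ∀ {m n} → Ren m n → Ctx m → Ctx n → Set
  TypedRen ρ Γ Δ = ∀ x → Δ (ρ x) ≡ Γ x

  TypedSub : ∀ {m n} → Sub m n → Ctx m → Ctx n → Set (a ⊔ ι)
  TypedSub σ Γ Δ = ∀ x → Δ ⊩ σ x ∶ Γ x

  rename-⊩ : ∀ {m n} {Γ : Ctx m} {Δ : Ctx n} {ρ M t} →
             TypedRen ρ Γ Δ → Γ ⊩ M ∶ t → Δ ⊩ rename ρ M ∶ t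
  rename-⊩ h (var {x} e)  = var (≡.subst (_≃ _) (sym (h x)) e)
  rename-⊩ h (lam e d)    = lam e (rename-⊩ (λ { zero → refl ; (suc x) → h x }) d)
  rename-⊩ h (app e d d′) = app e (rename-⊩ h d) (rename-⊩ h d′)

  liftSub-typed : ∀ {m n} {Γ : Ctx m} {Δ : Ctx n} {σ u} →
                  TypedSub σ Γ Δ → TypedSub (liftSub σ) (u ▸ Γ) (u ▸ Δ)
  liftSub-typed h zero    = var ≈refl
  liftSub-typed h (suc x) = rename-⊩ (λ _ → refl) (h x)

  ∷ˢ-typed : ∀ {m n} {Γ : Ctx m} {Δ : Ctx n} {σ u N} →
             Δ ⊩ N ∶ u → TypedSub σ Γ Δ → TypedSub (N ∷ˢ σ) (u ▸ Γ) Δ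
  ∷ˢ-typed d h zero    = d
  ∷ˢ-typed d h (suc x) = h x

  singleSub-typed : ∀ {n} {Γ : Ctx n} {u N} → Γ ⊩ N ∶ u → TypedSub (singleSub N) (u ▸ Γ) Γ
  singleSub-typed d zero    = d
  singleSub-typed d (suc x) = var ≈refl

  subst-⊩ : ∀ {m n} {Γ : Ctx m} {Δ : Ctx n} {σ M t} →
            TypedSub σ Γ Δ → Γ ⊩ M ∶ t → Δ ⊩ subst σ M ∶ t
  subst-⊩ h (var e)      = conv-⊩ e (h _)
  subst-⊩ h (lam e d)    = lam e (subst-⊩ (liftSub-typed h) d)
  subst-⊩ h (app e d d′) = app e (subst-⊩ h d) (subst-⊩ h d′)

  -- Injectivity of arrows matches the domain of the abstraction with the type of the argument. The
  -- argument is typed as well, because recursion through `expand` also visits it and `M′` may have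
  -- erased it.
  ⟶-⊩ : ∀ {n} {Γ : Ctx n} {M N M′ t} →
        M ⟶[ N ] M′ → Γ ⊩ M ∶ t → Γ ⊩ M′ ∶ t × ∃ λ u → Γ ⊩ N ∶ u
  ⟶-⊩ β (app e (lam e′ d) d′) with eu , ev ← Arrow-injective e e′ =
    conv-⊩ (≈sym ev) (subst-⊩ (singleSub-typed (conv-⊩ eu d′)) d) , _ , d′
  ⟶-⊩ (·ˡ h) (app e d d′) with d₁ , d₂ ← ⟶-⊩ h d = app e d₁ d′ , d₂

  -- Spines of arguments and substitution of applicable terms

  data Args {n : ℕ} (Δ : Ctx n) : Node → Set (a ⊔ ι) where
    []   : ∀ {t} → Args Δ t
    cons : ∀ {N t u v} → Arrow t u v → Δ ⊩ N ∶ u → SN N → Args Δ v → Args Δ t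

  infixl 7 _·*_

  _·*_ : ∀ {n} {Δ : Ctx n} {t} → Term n → Args Δ t → Term n
  M ·* []                  = M
  M ·* cons {N = N} _ _ _ as = M · N ·* as

  ·*-⟶ : ∀ {n} {Δ : Ctx n} {M N M′ t} (as : Args Δ t) →
         M ⟶[ N ] M′ → M ·* as ⟶[ N ] M′ ·* as
  ·*-⟶ []              h = h
  ·*-⟶ (cons _ _ _ as) h = ·*-⟶ as (·ˡ h)

  ·*-SNe : ∀ {n} {Δ : Ctx n} {M t} → SNe M → (as : Args Δ t) → SN (M ·* as)
  ·*-SNe ne []               = neutral ne
  ·*-SNe ne (cons _ _ sn as) = ·*-SNe (ne · sn) as

  -- Unlike Tait's reducibility, this involves no recursion on types: the arguments are merely typed
  -- and strongly normalizing. Quantifying over renamings lets it pass under binders.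
  Applicable : ∀ {n} → Ctx n → Node → Term n → Set (a ⊔ ι)
  Applicable {n} Γ t M = ∀ {k} {Δ : Ctx k} (ρ : Ren n k) → TypedRen ρ Γ Δ →
    ∀ {t′} → t ≃ t′ → (as : Args Δ t′) → SN (rename ρ M ·* as)

  Applicable⇒SN : ∀ {n} {Γ : Ctx n} {t M} → Applicable Γ t M → SN M
  Applicable⇒SN {M = M} b =
    ≡.subst SN (rename-id (λ _ → refl) M) (b id (λ _ → refl) ≈refl [])

  SNe⇒Applicable : ∀ {n} {Γ : Ctx n} {t M} → SNe M → Applicable Γ t M
  SNe⇒Applicable ne ρ _ _ as = ·*-SNe (rename-SNe ρ ne) as

  Applicable-rename : ∀ {m n} {Γ : Ctx m} {Δ : Ctx n} {ρ t M} → TypedRen ρ Γ Δ →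
                      Applicable Γ t M → Applicable Δ t (rename ρ M)
  Applicable-rename {ρ = ρ} {M = M} h b ρ′ h′ e as =
    ≡.subst (λ K → SN (K ·* as)) (sym (rename-rename (λ _ → refl) M))
      (b (ρ′ ∘ ρ) (λ x → trans (h′ (ρ x)) (h x)) e as)

  ApplicableSub : ∀ {m n} → Sub m n → Ctx m → Ctx n → Set (a ⊔ ι)
  ApplicableSub σ Γ Δ = ∀ x → Applicable Δ (Γ x) (σ x)

  liftSub-applicable : ∀ {m n} {Γ : Ctx m} {Δ : Ctx n} {σ u} →
                       ApplicableSub σ Γ Δ → ApplicableSub (liftSub σ) (u ▸ Γ) (u ▸ Δ)
  liftSub-applicable         b zero    = SNe⇒Applicable (var zero)
  liftSub-applicable {σ = σ} b (suc x) = Applicable-rename {M = σ x} (λ _ → refl) (b x)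

  -- Induction on the derivation of `SN M`. The head variable of a neutral term becomes an
  -- applicable term, which absorbs the arguments, strongly normalizing by induction.
  mutual
    subst-applicable-SN : ∀ {m n} {Γ : Ctx m} {Δ : Ctx n} {σ M t} → TypedSub σ Γ Δ →
                          ApplicableSub σ Γ Δ → Γ ⊩ M ∶ t → SN M → SN (subst σ M)
    subst-applicable-SN {σ = σ} {M} h b d (neutral ne) =
      Applicable⇒SN {M = subst σ M} (subst-applicable-SNe h b d ne)
    subst-applicable-SN h b (lam e d) (ƛ sn) =
      ƛ subst-applicable-SN (liftSub-typed h) (liftSub-applicable b) d sn
    subst-applicable-SN h b d (expand r n m) with d₁ , _ , d₂ ← ⟶-⊩ r d =
      expand (subst-⟶ _ r) (subst-applicable-SN h b d₂ n) (subst-applicable-SN h b d₁ m)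

    subst-applicable-SNe : ∀ {m n} {Γ : Ctx m} {Δ : Ctx n} {σ M t} → TypedSub σ Γ Δ →
                           ApplicableSub σ Γ Δ → Γ ⊩ M ∶ t → SNe M → Applicable Δ t (subst σ M)
    subst-applicable-SNe h b (var e) (var x) ρ hρ e′ as = b x ρ hρ (≈trans e e′) as
    subst-applicable-SNe h b (app e d d′) (ne · sn) ρ hρ e′ as =
      subst-applicable-SNe h b d ne ρ hρ ≈refl
        (cons (≈trans e (≈cong ≈refl e′)) (rename-⊩ hρ (subst-⊩ h d′))
              (rename-SN ρ (subst-applicable-SN h b d′ sn)) as)

  -- At an abstraction, contraction substitutes the applicable `N`. The hypothesis on `N` covers
  -- every presentation of `t` as an arrow, since the abstraction brings its own domain node.
  SN-· : ∀ {n} {Γ : Ctx n} {M N t} → Γ ⊩ M ∶ t → SN M → SN N →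
         (∀ {u v} → Arrow t u v → Γ ⊩ N ∶ u × Applicable Γ u N) → SN (M · N)
  SN-· d         (neutral ne)     n b = neutral (ne · n)
  SN-· {N = N} (lam e d) (ƛ sn)   n b with d′ , bN ← b e =
    expand β n (subst-applicable-SN (singleSub-typed d′) applicable d sn)
    where
    applicable : ApplicableSub (singleSub N) _ _
    applicable zero    = bN
    applicable (suc x) = SNe⇒Applicable (var x)
  SN-· d         (expand r n′ m)  n b with d₁ , _ ← ⟶-⊩ r d =
    expand (·ˡ r) n′ (SN-· d₁ m n b)

  SNApplies : Node → Set (a ⊔ ι)
  SNApplies t = ∀ {n} {Γ : Ctx n} {M} → Γ ⊩ M ∶ t → SN M → (as : Args Γ t) → SN (M ·* as)

  -- The step of the well-founded induction on nodes

  module _ {s : Node} (ih : ∀ {t} → t ≺ s → SNApplies t) where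

    -- The first alternative covers variables left in place, the second arguments absorbed from a
    -- spine.
    NeutralOrNegative : ∀ {n} → Node → Term n → Set (a ⊔ ι)
    NeutralOrNegative t M = SNe M ⊎ (Path s - t × SN M)

    NegativeSub : ∀ {m n} → Sub m n → Ctx m → Set (a ⊔ ι)
    NegativeSub σ Γ = ∀ x → NeutralOrNegative (Γ x) (σ x)

    rename-NeutralOrNegative : ∀ {m n t M} (ρ : Ren m n) →
      NeutralOrNegative t M → NeutralOrNegative t (rename ρ M)
    rename-NeutralOrNegative ρ (inj₁ ne)       = inj₁ (rename-SNe ρ ne)
    rename-NeutralOrNegative ρ (inj₂ (π , sn)) = inj₂ (π , rename-SN ρ sn)

    liftSub-negative : ∀ {m n} {Γ : Ctx m} {σ : Sub m n} {u} →
                       NegativeSub σ Γ → NegativeSub (liftSub σ) (u ▸ Γ)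
    liftSub-negative g zero    = inj₁ (var zero)
    liftSub-negative g (suc x) = rename-NeutralOrNegative suc (g x)

    -- Simultaneous induction on the derivation of `SN M` for the term before substitution, so that
    -- the substitution may grow and the spine may be arbitrary.
    mutual
      subst-negative-SN : ∀ {m n} {Γ : Ctx m} {Δ : Ctx n} {σ M t} → TypedSub σ Γ Δ →
        NegativeSub σ Γ → Γ ⊩ M ∶ t → SN M → SN (subst σ M)
      subst-negative-SN h g d (neutral ne) with subst-negative-SNe h g d ne
      ... | inj₁ ne′      = neutral ne′
      ... | inj₂ (_ , sn) = sn
      subst-negative-SN h g (lam e d) (ƛ sn) =
        ƛ subst-negative-SN (liftSub-typed h) (liftSub-negative g) d sn
      subst-negative-SN h g d (expand r n m) with d₁ , _ , d₂ ← ⟶-⊩ r d =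
        expand (subst-⟶ _ r) (subst-negative-SN h g d₂ n) (subst-negative-SN h g d₁ m)

      subst-negative-SNe : ∀ {m n} {Γ : Ctx m} {Δ : Ctx n} {σ M t} → TypedSub σ Γ Δ →
        NegativeSub σ Γ → Γ ⊩ M ∶ t → SNe M → NeutralOrNegative t (subst σ M)
      subst-negative-SNe h g (var e) (var x) with g x
      ... | inj₁ ne       = inj₁ ne
      ... | inj₂ (π , sn) = inj₂ (Path-conv π e , sn)
      subst-negative-SNe {σ = σ} h g (app {N = N} e d d′) (ne · sn)
        with subst-negative-SNe h g d ne
      ... | inj₁ ne′       = inj₁ (ne′ · subst-negative-SN h g d′ sn)
      -- The type of the function part is negatively reachable, so its domain is positively
      -- reachable, which makes the substituted argument applicable.
      ... | inj₂ (π , sn′) = inj₂ (cod π e ,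
        SN-· (subst-⊩ h d) sn′ (subst-negative-SN h g d′ sn) λ e′ →
          let d″ = conv-⊩ (proj₁ (Arrow-injective e e′)) d′
          in subst-⊩ h d″ , subst-negative-applicable h g d″ (dom π e′) sn)

      subst-negative-applicable : ∀ {m n} {Γ : Ctx m} {Δ : Ctx n} {σ M t} → TypedSub σ Γ Δ →
        NegativeSub σ Γ → Γ ⊩ M ∶ t → Path s + t → SN M → Applicable Δ t (subst σ M)
      subst-negative-applicable {M = M} h g d π sn ρ hρ e as =
        -- The renaming is merged into the substitution, leaving the derivation for `M` unchanged.
        ≡.subst (λ K → SN (K ·* as)) (sym (rename-subst (λ _ → refl) M))
          (subst-negative-·* (λ x → rename-⊩ hρ (h x)) (λ x → rename-NeutralOrNegative ρ (g x))
            (conv-⊩ e d) (Path-conv π e) sn as)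

      subst-negative-·* : ∀ {m n} {Γ : Ctx m} {Δ : Ctx n} {σ M t} → TypedSub σ Γ Δ →
        NegativeSub σ Γ → Γ ⊩ M ∶ t → Path s + t → SN M →
        (as : Args Δ t) → SN (subst σ M ·* as)
      subst-negative-·* h g d π (neutral ne) as with subst-negative-SNe h g d ne
      ... | inj₁ ne′       = ·*-SNe ne′ as
      ... | inj₂ (π⁻ , sn) = ih (π , π⁻) (subst-⊩ h d) sn as
      subst-negative-·* h g (lam e d) π (ƛ sn) [] =
        ƛ subst-negative-SN (liftSub-typed h) (liftSub-negative g) d sn
      subst-negative-·* {σ = σ} h g (lam {M} e d) π (ƛ sn) (cons {N} e′ dN n as)
        with eu , ev ← Arrow-injective e e′ =
        expand (·*-⟶ as (⟶-≡ β (subst-liftSub-[] σ M N))) n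
          (subst-negative-·* (∷ˢ-typed (conv-⊩ (≈sym eu) dN) h)
            -- The first argument joins the substitution: its type is the domain of a positively
            -- reachable arrow, hence negatively reachable.
            (λ { zero → inj₂ (dom π e , n) ; (suc x) → g x })
            (conv-⊩ ev d) (cod π e′) sn as)
      subst-negative-·* h g d π (expand r n m) as with d₁ , _ , d₂ ← ⟶-⊩ r d =
        expand (·*-⟶ as (subst-⟶ _ r)) (subst-negative-SN h g d₂ n)
          (subst-negative-·* h g d₁ π m as)

    SNApplies-step : SNApplies s
    SNApplies-step {M = M} d sn as =
      -- The identity substitution has only neutral entries, and `s` reaches itself by the empty
      -- path.
      ≡.subst (λ K → SN (K ·* as)) (subst-id (λ _ → refl) M)
        (subst-negative-·* (λ _ → var ≈refl) (λ x → inj₁ (var x)) d (done ≈refl) sn as)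

  snApplies : ∀ t → SNApplies t
  snApplies = WF.All.wfRec ≺-wellFounded (a ⊔ ι) SNApplies λ _ ih → SNApplies-step ih

  ⊩⇒SN : ∀ {n} {Γ : Ctx n} {M t} → Γ ⊩ M ∶ t → SN M
  ⊩⇒SN (var {x} _)  = neutral (var x)
  ⊩⇒SN (lam _ d)    = ƛ ⊩⇒SN d
  ⊩⇒SN (app e d d′) = snApplies _ d (⊩⇒SN d) (cons e d′ (⊩⇒SN d′) [])

  HasNode : Ty A I → Set (a ⊔ ι)
  HasNode T = ∃ λ t → ty t ≡ T

-- Translation of derivations

module _ {a ι : Level} {A : Set a} {I : Set ι} {F : I → Ty A I} where

  -- The rule `ax` adds nothing: its type is in the context, hence either there from the start or
  -- added by a `lam`.
  types : ∀ {n} {Γ : Vec (Ty A I) n} {M T} → F ∣ Γ ⊢ M ⦂ T → List (Ty A I)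
  types (ax x)              = []
  types (conv {V = V} d _)  = V ∷ types d
  types (lam {U = U} {V} d) = U ∷ (U ⇒ V) ∷ types d
  types (app {V = V} d d′)  = V ∷ types d ++ types d′

  module _ (good : Good F) {size : ℕ} (ty : Fin size → Ty A I) where
    open Graph F good ty

    ⊢⇒⊩ : ∀ {n} {Γ : Vec (Ty A I) n} {M T} (γ : Ctx n) → (∀ x → ty (γ x) ≡ lookup Γ x) →
          (d : F ∣ Γ ⊢ M ⦂ T) → All HasNode (types d) → ∃ λ t → ty t ≡ T × γ ⊩ M ∶ t
    ⊢⇒⊩ γ h (ax x) _ = γ x , h x , var ≈refl
    ⊢⇒⊩ γ h (conv d e) ((v , refl) ∷ ns)
      with _ , refl , d′ ← ⊢⇒⊩ γ h d ns
      = v , refl , conv-⊩ e d′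
    ⊢⇒⊩ γ h (lam d) ((u , refl) ∷ (t , eq) ∷ ns)
      with _ , refl , d′ ← ⊢⇒⊩ (u ▸ γ) (λ { zero → refl ; (suc x) → h x }) d ns
      = t , eq , lam (≡.subst (F ⊢ ty t ≈_) eq ≈refl) d′
    ⊢⇒⊩ γ h (app d d′) ((v , refl) ∷ ns)
      with t , eq , e ← ⊢⇒⊩ γ h d (++⁻ˡ (types d) ns)
      with _ , refl , e′ ← ⊢⇒⊩ γ h d′ (++⁻ʳ (types d) ns)
      = v , refl , app (≡.subst (F ⊢ ty t ≈_) eq ≈refl) e e′

mainTheorem1 : {a ι : Level} {A : Set a} {I : Set ι} (F : I → Ty A I) → Good F →
    ∀ (n : ℕ) (Γ : Vec (Ty A I) n) (M : Term n) (T : Ty A I) →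
    F ∣ Γ ⊢ M ⦂ T → StronglyNormalizing M
mainTheorem1 F good n Γ M T d =
  Halts⇒StronglyNormalizing (SN⇒Halts (⊩⇒SN (proj₂ (proj₂ derivation))))
  where
  -- Nodes are positions in this list; repeated types give distinct nodes related by `≃`.
  L = List.tabulate (lookup Γ) ++ types d

  open Graph F good (List.lookup L)

  hasNode : All HasNode L
  hasNode = All.tabulate λ T∈L → index T∈L , sym (lookup-index T∈L)

  ctx : ∀ x → HasNode (lookup Γ x)
  ctx x = All.lookup (++⁻ˡ (List.tabulate (lookup Γ)) hasNode) (∈-tabulate⁺ x)

  derivation = ⊢⇒⊩ good (List.lookup L) (proj₁ ∘ ctx) (proj₂ ∘ ctx) d
    (++⁻ʳ (List.tabulate (lookup Γ)) hasNode)
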